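{- Let $F=(W,\geq,\mathrm{R})$ be an ordered frame and $M=(F,L,V)$ an awareness model for $\mathcal{L}^{A,K}(\mathbb{P})$. Let $\mathbf{2W}$ be the concrete relativized Boolean algebra based on $W$, equipped with the operator $f^{K,R}$, and let $h^M:\mathcal{L}(\mathbb{P})\to\mathbf{2W}$ be the homomorphism defined by $h^M(p)=(V(p),L(p))$ for $p\in\mathbb{P}$. Then for every $\phi\in\mathcal{L}^{A,K}(\mathbb{P})$, $$h^{M+}(\phi)=(V(\phi),L(\phi)).$$
   Context: Languages. $\mathbb{P}$ is a set of propositional variables. $\mathcal{L}(\mathbb{P})$ has grammar $\phi::=p\mid 1\mid\neg\phi\mid(\phi\land\phi)$, $p\in\mathbb{P}$, with $0\equiv\neg1$, $\phi\lor\psi\equiv\neg(\neg\phi\land\neg\psi)$. $\mathcal{L}^{A,K}(\mathbb{P})$ has grammar $\phi::=p\mid 1\mid\neg\phi\mid(\phi\land\phi)\mid A\phi\mid K\phi$. $\mathcal{L}(\mathbb{P})$ is also regarded as an algebra with operations given by the connectives; a homomorphism to an algebra $\langle RB,\land,\lor,\neg,0,1\rangle$ is a map sending $1$ to $1$ and respecting $\land,\lor,\neg$. Awareness models. An ordered frame is a pre-ordered set $(W,\geq)$ with a serial binary relation $\mathrm{R}$ on $W$; $\mathrm{R}(\omega)=\{\omega'\mid\omega\mathrm{R}\omega'\}$. An awareness model is $M=(W,\geq,\mathrm{R},L,V)$ with $(W,\geq,\mathrm{R})$ an ordered frame and $L,V:\mathbb{P}\to\mathscr{P}(W)$ such that $L(p)$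 is $\geq$-upward closed and $V(p)\subseteq L(p)$ for all $p$. The language at $\omega$ is $\mathcal{L}^{A,K}(\omega):=\mathcal{L}^{A,K}(\{p\in\mathbb{P}\mid\omega\in L(p)\})$. Truth at $\omega$ is defined only for formulas $\phi\in\mathcal{L}^{A,K}(\omega)$ (if $\phi\notin\mathcal{L}^{A,K}(\omega)$ then $\langle M,\omega\rangle\not\models\phi$), and for formulas in $\mathcal{L}^{A,K}(\omega)$ recursively by: $\langle M,\omega\rangle\models 1$ always; $\langle M,\omega\rangle\models p$ iff $\omega\in V(p)$; $\langle M,\omega\rangle\models\neg\phi$ iff $\langle M,\omega\rangle\not\models\phi$; $\langle M,\omega\rangle\models\phi\land\psi$ iff $\langle M,\omega\rangle\models\phi$ and $\langle M,\omega\rangle\models\psi$; $\langle M,\omega\rangle\models A\phi$ iff $\phi\in\mathcal{L}^{A,K}(\omega')$ for all $\omega'\in\mathrm{R}(\omega)$; $\langle M,\omega\rangle\models K\phi$ iff $\langle M,\omega'\rangle\models\phi$ for all $\omega'\in\mathrm{R}(\omega)$. For every formula, $V(\phi)=\{\omega\mid\langle M,\omega\rangle\models\phi\}$ and $L(\phi)=\{\omega\mid\phi\in\mathcal{L}^{A,K}(\omega)\}$. Concrete algebra. $\mathbf{2W}$ has underlying set $\{(A,B)\mid A\subseteq B\subseteq W\}$, bottom $(\emptyset,\emptyset)$, top $(W,W)$, and operations $\neg(A,B)=(B\setminus A,B)$, $(A,B)\land(A',B')=(A\cap A',B\cap B')$, $(A,B)\lor(A',B')=((A\cup A')\cap(B\cap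 B'),B\cap B')$. Write $1_X:=X\lor\neg X$, so $1_{(A,B)}=(B,B)$. The operator is $$f^{K,R}:(A,B)\mapsto(\{\omega\mid\mathrm{R}(\omega)\subseteq A\}\cap B,\,B),$$ and $f^{A,R}(X):=f^{K,R}(1_X)$. The extension $h^{M+}:\mathcal{L}^{A,K}(\mathbb{P})\to\mathbf{2W}$ of $h^M$ respects $1,\neg,\land$ and satisfies $h^{M+}(K\phi)=f^{K,R}(h^{M+}(\phi))$ and $h^{M+}(A\phi)=f^{A,R}(h^{M+}(\phi))$. -}

module Defs where

open import Level using (Level; suc)
open import Axiom.ExcludedMiddle using (ExcludedMiddle)
open import Data.Empty using (⊥-elim)
open import Data.Product using (∃-syntax; _×_; _,_; proj₁; proj₂)
open import Data.Sum using (inj₁; inj₂; [_,_]′)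
open import Function using (id)
open import Relation.Binary using (Rel; IsPreorder)
open import Relation.Binary.PropositionalEquality using (_≡_; refl)
open import Relation.Nullary using (¬_; yes; no)
open import Relation.Unary using (Pred; _∈_; _⊆_; _≐_; _∩_; _∪_; _∖_)
open import Relation.Unary.Properties using (≐-refl)
open import Relation.Unary.Polymorphic using (∅; U)

private
  variable
    ℓ : Level

infix  8 ~_
infixr 7 _∧_
infixr 6 _∨_

data Form (ℙ : Set ℓ) : Set ℓ where
  var : ℙ → Form ℙ
  𝟙   : Form ℙ
  ~_  : Form ℙ → Form ℙ
  _∧_ : Form ℙ → Form ℙ → Form ℙ

_∨_ : {ℙ : Set ℓ} → Form ℙ → Form ℙ → Form ℙ
φ ∨ ψ = ~ (~ φ ∧ ~ ψ)

data FormAK (ℙ : Set ℓ) : Set ℓ where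
  var : ℙ → FormAK ℙ
  𝟙   : FormAK ℙ
  ~_  : FormAK ℙ → FormAK ℙ
  _∧_ : FormAK ℙ → FormAK ℙ → FormAK ℙ
  A K : FormAK ℙ → FormAK ℙ

embed : {ℙ : Set ℓ} → Form ℙ → FormAK ℙ
embed (var p) = var p
embed 𝟙       = 𝟙
embed (~ φ)   = ~ embed φ
embed (φ ∧ ψ) = embed φ ∧ embed ψ

-- 𝓛ᴬᴷ Q is the sublanguage over the subset Q of ℙ, as a subset of FormAK ℙ.
data 𝓛ᴬᴷ {ℙ : Set ℓ} (Q : Pred ℙ ℓ) : Pred (FormAK ℙ) ℓ where
  var : ∀ {p} → p ∈ Q → var p ∈ 𝓛ᴬᴷ Q
  𝟙   : 𝟙 ∈ 𝓛ᴬᴷ Q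
  ~_  : ∀ {φ} → φ ∈ 𝓛ᴬᴷ Q → ~ φ ∈ 𝓛ᴬᴷ Q
  _∧_ : ∀ {φ ψ} → φ ∈ 𝓛ᴬᴷ Q → ψ ∈ 𝓛ᴬᴷ Q → φ ∧ ψ ∈ 𝓛ᴬᴷ Q
  A   : ∀ {φ} → φ ∈ 𝓛ᴬᴷ Q → A φ ∈ 𝓛ᴬᴷ Q
  K   : ∀ {φ} → φ ∈ 𝓛ᴬᴷ Q → K φ ∈ 𝓛ᴬᴷ Q

record OrderedFrame (ℓ : Level) : Set (suc ℓ) where
  infix 4 _≥_
  field
    W          : Set ℓ
    _≥_        : Rel W ℓ
    isPreorder : IsPreorder _≡_ _≥_
    R          : Rel W ℓ
    serial     : ∀ ω → ∃[ ω′ ] R ω ω′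

record AwarenessModel (F : OrderedFrame ℓ) (ℙ : Set ℓ) : Set (suc ℓ) where
  open OrderedFrame F
  field
    L V      : ℙ → Pred W ℓ
    L-upward : ∀ p {ω ω′} → ω′ ≥ ω → ω ∈ L p → ω′ ∈ L p
    V⊆L      : ∀ p → V p ⊆ L p

module Semantics {F : OrderedFrame ℓ} {ℙ : Set ℓ} (M : AwarenessModel F ℙ) where
  open OrderedFrame F
  open AwarenessModel M

  𝓛At : W → Pred (FormAK ℙ) ℓ
  𝓛At ω = 𝓛ᴬᴷ (λ p → ω ∈ L p)

  -- Clause gives the recursive truth conditions, which apply only to
  -- formulas of the language at ω; outside that language ω ⊨ φ fails.
  infix 4 _⊨_
  mutual
    _⊨_ : W → FormAK ℙ → Set ℓ
    ω ⊨ φ = φ ∈ 𝓛At ω × Clause ω φ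

    Clause : W → FormAK ℙ → Set ℓ
    Clause ω (var p) = ω ∈ V p
    Clause ω 𝟙       = ω ∈ U
    Clause ω (~ φ)   = ¬ (ω ⊨ φ)
    Clause ω (φ ∧ ψ) = ω ⊨ φ × ω ⊨ ψ
    Clause ω (A φ)   = ∀ ω′ → R ω ω′ → φ ∈ 𝓛At ω′
    Clause ω (K φ)   = ∀ ω′ → R ω ω′ → ω′ ⊨ φ

  V⟦_⟧ L⟦_⟧ : FormAK ℙ → Pred W ℓ
  V⟦ φ ⟧ ω = ω ⊨ φ
  L⟦ φ ⟧ ω = φ ∈ 𝓛At ω

  V⟦_⟧⊆L : ∀ φ → V⟦ φ ⟧ ⊆ L⟦ φ ⟧
  V⟦ φ ⟧⊆L = proj₁

record 𝟐 (W : Set ℓ) : Set (suc ℓ) where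
  constructor ⟨_,_∣_⟩
  field
    fst     : Pred W ℓ
    snd     : Pred W ℓ
    fst⊆snd : fst ⊆ snd

open 𝟐 public

-- Equality of pairs of subsets: extensional in each component, ignoring
-- the inclusion proof.
infix 4 _≈_
_≈_ : {W : Set ℓ} → 𝟐 W → 𝟐 W → Set ℓ
X ≈ Y = (fst X ≐ fst Y) × (snd X ≐ snd Y)

module _ {W : Set ℓ} where

  infix  8 ⊖_
  infixr 7 _⊓_
  infixr 6 _⊔_

  bot top : 𝟐 W
  bot = ⟨ ∅ , ∅ ∣ id ⟩
  top = ⟨ U , U ∣ id ⟩

  ⊖_ : 𝟐 W → 𝟐 W
  ⊖ ⟨ S , T ∣ _ ⟩ = ⟨ T ∖ S , T ∣ proj₁ ⟩

  _⊓_ _⊔_ : 𝟐 W → 𝟐 W → 𝟐 W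
  ⟨ S , T ∣ i ⟩ ⊓ ⟨ S′ , T′ ∣ i′ ⟩ =
    ⟨ S ∩ S′ , T ∩ T′ ∣ (λ (a , a′) → i a , i′ a′) ⟩
  ⟨ S , T ∣ _ ⟩ ⊔ ⟨ S′ , T′ ∣ _ ⟩ =
    ⟨ (S ∪ S′) ∩ (T ∩ T′) , T ∩ T′ ∣ proj₂ ⟩

  -- 𝟏[ ⟨ S , T ∣ i ⟩ ] has both components T classically; constructively its
  -- first component contains only those points of T where S is decided.
  𝟏[_] : 𝟐 W → 𝟐 W
  𝟏[ X ] = X ⊔ ⊖ X

  fᴷ : Rel W ℓ → 𝟐 W → 𝟐 W
  fᴷ R ⟨ S , T ∣ _ ⟩ = ⟨ (λ ω → R ω ⊆ S) ∩ T , T ∣ proj₂ ⟩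

  fᴬ : Rel W ℓ → 𝟐 W → 𝟐 W
  fᴬ R X = fᴷ R 𝟏[ X ]

record IsHomomorphism {ℙ W : Set ℓ} (h : Form ℙ → 𝟐 W) : Set ℓ where
  field
    𝟙-homo : h 𝟙 ≈ top
    ~-homo : ∀ φ → h (~ φ) ≈ ⊖ h φ
    ∧-homo : ∀ φ ψ → h (φ ∧ ψ) ≈ h φ ⊓ h ψ
    ∨-homo : ∀ φ ψ → h (φ ∨ ψ) ≈ h φ ⊔ h ψ

module Interpretation {F : OrderedFrame ℓ} {ℙ : Set ℓ} (M : AwarenessModel F ℙ) where
  open OrderedFrame F
  open AwarenessModel M

  hᴹ : Form ℙ → 𝟐 W
  hᴹ (var p) = ⟨ V p , L p ∣ V⊆L p ⟩
  hᴹ 𝟙       = top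
  hᴹ (~ φ)   = ⊖ hᴹ φ
  hᴹ (φ ∧ ψ) = hᴹ φ ⊓ hᴹ ψ

  hᴹ⁺ : FormAK ℙ → 𝟐 W
  hᴹ⁺ (var p) = hᴹ (var p)
  hᴹ⁺ 𝟙       = top
  hᴹ⁺ (~ φ)   = ⊖ hᴹ⁺ φ
  hᴹ⁺ (φ ∧ ψ) = hᴹ⁺ φ ⊓ hᴹ⁺ ψ
  hᴹ⁺ (A φ)   = fᴬ R (hᴹ⁺ φ)
  hᴹ⁺ (K φ)   = fᴷ R (hᴹ⁺ φ)

  hᴹ⁺-extends : ∀ φ → hᴹ⁺ (embed φ) ≡ hᴹ φ
  hᴹ⁺-extends (var p) = refl
  hᴹ⁺-extends 𝟙       = refl
  hᴹ⁺-extends (~ φ)   rewrite hᴹ⁺-extends φ = refl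
  hᴹ⁺-extends (φ ∧ ψ) rewrite hᴹ⁺-extends φ | hᴹ⁺-extends ψ = refl

  -- Excluded middle is needed only for ∨, a derived connective on formulas
  -- but an explicitly defined operation on pairs.
  hᴹ-isHomomorphism : ExcludedMiddle ℓ → IsHomomorphism hᴹ
  hᴹ-isHomomorphism em = record
    { 𝟙-homo = ≐-refl , ≐-refl
    ; ~-homo = λ _ → ≐-refl , ≐-refl
    ; ∧-homo = λ _ _ → ≐-refl , ≐-refl
    ; ∨-homo = λ φ ψ → (to φ ψ , from φ ψ) , ≐-refl
    }
    where
    to : ∀ φ ψ → fst (hᴹ (φ ∨ ψ)) ⊆ fst (hᴹ φ ⊔ hᴹ ψ)
    to φ ψ {ω} ((b , b′) , n) with em {ω ∈ fst (hᴹ φ)} | em {ω ∈ fst (hᴹ ψ)}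
    ... | yes a | _      = inj₁ a , b , b′
    ... | no _  | yes a′ = inj₂ a′ , b , b′
    ... | no ¬a | no ¬a′ = ⊥-elim (n ((b , ¬a) , (b′ , ¬a′)))

    from : ∀ φ ψ → fst (hᴹ φ ⊔ hᴹ ψ) ⊆ fst (hᴹ (φ ∨ ψ))
    from φ ψ (a⊎a′ , b , b′) =
      (b , b′) , λ ((_ , ¬a) , (_ , ¬a′)) → [ ¬a , ¬a′ ]′ a⊎a′

{-# OPTIONS --safe #-}

module Submission where

open import Defs
open import Level using (Level)
open import Axiom.ExcludedMiddle using (ExcludedMiddle)
open import Data.Product using (_×_; _,_; proj₁; proj₂; map)
open import Data.Sum using (_⊎_; inj₁; inj₂)
open import Function using (_∘_)
open import Relation.Nullary using (¬_; yes; no)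
open import Relation.Unary using (_≐_)

-- Induction on the formula, with both components treated at once: the second component records the
-- language guard, and the operations on pairs copy the truth clauses under that guard. Only `A`
-- needs more. Its clause says that every successor lies in `L⟦ φ ⟧`, whereas `fᴬ` tests successors
-- against the first component of `𝟏[ X ]`; `fst-𝟏` identifies that component with `snd X`.

private
  variable
    ℓ : Level

-- Excluded middle enters here: each point of `snd X` lies in `fst X` or in its relative complement.
fst-𝟏 : ExcludedMiddle ℓ → {W : Set ℓ} (X : 𝟐 W) → fst 𝟏[ X ] ≐ snd X
fst-𝟏 em X = (proj₁ ∘ proj₂) , λ b → split b , b , b
  where
  split : ∀ {ω} → snd X ω → fst X ω ⊎ snd X ω × ¬ fst X ω
  split {ω} b with em {fst X ω}
  ... | yes a = inj₁ a
  ... | no ¬a = inj₂ (b , ¬a)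

proposition5 : {ℓ : Level} → ExcludedMiddle ℓ →
    (ℙ : Set ℓ) (F : OrderedFrame ℓ) (M : AwarenessModel F ℙ) →
    let open Semantics M
        open Interpretation M
    in (φ : FormAK ℙ) → hᴹ⁺ φ ≈ ⟨ V⟦ φ ⟧ , L⟦ φ ⟧ ∣ V⟦ φ ⟧⊆L ⟩
proposition5 {ℓ} em ℙ F M = rec
  where
  open AwarenessModel M
  open Semantics M
  open Interpretation M

  rec : (φ : FormAK ℙ) → hᴹ⁺ φ ≈ ⟨ V⟦ φ ⟧ , L⟦ φ ⟧ ∣ V⟦ φ ⟧⊆L ⟩
  rec (var p) =
    ((λ v → var (V⊆L p v) , v) , proj₂) , var , λ { (var l) → l }
  rec 𝟙 = ((λ u → 𝟙 , u) , proj₂) , (λ _ → 𝟙) , λ _ → _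
  rec (~ φ) with rec φ
  ... | (V→ , V←) , (L→ , L←) =
    -- Negation is contravariant, so each direction uses the opposite inclusion for `V`.
    (map (~_ ∘ L→) (_∘ V←) , λ { (~ l , n) → L← l , n ∘ V→ }) ,
    ~_ ∘ L→ , λ { (~ l) → L← l }
  rec (φ ∧ ψ) with rec φ | rec ψ
  ... | (V→ , V←) , (L→ , L←) | (V→′ , V←′) , (L→′ , L←′) =
    ((λ (a , b) → (proj₁ (V→ a) ∧ proj₁ (V→′ b)) , V→ a , V→′ b) ,
     λ (_ , a , b) → V← a , V←′ b) ,
    (λ (a , b) → L→ a ∧ L→′ b) , λ { (a ∧ b) → L← a , L←′ b }
  rec (A φ) with rec φ | fst-𝟏 em (hᴹ⁺ φ)
  ... | _ , (L→ , L←) | 𝟏→ , 𝟏← =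
    -- The second component of `𝟏[ X ]` is `snd X` intersected with itself, hence the duplicated
    -- language proofs.
    ((λ (r , l , _) → A (L→ l) , λ _ Rωω′ → L→ (𝟏→ (r Rωω′))) ,
     λ { (A l , r) → (λ {ω′} Rωω′ → 𝟏← (L← (r ω′ Rωω′))) , L← l , L← l }) ,
    A ∘ L→ ∘ proj₁ , λ { (A l) → L← l , L← l }
  rec (K φ) with rec φ
  ... | (V→ , V←) , (L→ , L←) =
    ((λ (r , l) → K (L→ l) , λ _ Rωω′ → V→ (r Rωω′)) ,
     λ { (K l , r) → (λ {ω′} Rωω′ → V← (r ω′ Rωω′)) , L← l }) ,
    K ∘ L→ , λ { (K l) → L← l }
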